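{- If $G$ is a block graph with $\operatorname{diam}(G) \leq 4$, then the $r$-independence complex $\mathrm{Ind}_r(G)$ is shellable for all integers $r \geq 2$.
   Context: All graphs are finite and simple. A block of a graph is a maximal connected subgraph that remains connected after removal of any single vertex; $G$ is a block graph if every block is a complete graph. $\operatorname{diam}(G)$ is the maximum over pairs of vertices of the length of a shortest path between them. For $r \geq 1$, a subset $A \subseteq V(G)$ is $r$-independent if every connected component of $G[A]$ has at most $r$ vertices; $\mathrm{Ind}_r(G)$ is the simplicial complex on $V(G)$ of all $r$-independent subsets. A (not necessarily pure) simplicial complex is shellable if its facets can be ordered $F_1,\dots,F_t$ so that for each $k>1$, $\langle F_k\rangle \cap \langle F_1,\dots,F_{k-1}\rangle$ is pure of dimension $\dim F_k-1$ ($\langle\mathcal F\rangle$ = complex generated by $\mathcal F$). -}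

module Defs where

open import Data.Nat using (ℕ; zero; suc; _≤_; _+_)
open import Data.Bool using (Bool; true; false)
open import Data.Fin using (Fin; toℕ)
open import Data.Fin.Subset using (Subset; _∈_; _⊆_; ∣_∣; _-_; ⊤)
open import Data.Product using (Σ; _×_; _,_; ∃-syntax)
open import Relation.Binary.PropositionalEquality using (_≡_; _≢_)
open import Function.Bundles using (_⇔_)
import Data.Nat as N

record Graph (n : ℕ) : Set where
  field
    adj    : Fin n → Fin n → Bool
    sym    : ∀ u v → adj u v ≡ adj v u
    irrefl : ∀ v → adj v v ≡ false
open Graph public

module _ {n : ℕ} (G : Graph n) where

  data Walk (A : Subset n) : Fin n → Fin n → ℕ → Set where
    here : ∀ {v} → v ∈ A → Walk A v v 0
    step : ∀ {u w v k} → u ∈ A → adj G u w ≡ true → Walk A w v k → Walk A u v (suc k)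

  Reach : Subset n → Fin n → Fin n → Set
  Reach A u v = ∃[ k ] Walk A u v k

  -- G[A] is connected (the empty graph counts as connected)
  Connected : Subset n → Set
  Connected A = ∀ u v → u ∈ A → v ∈ A → Reach A u v

  Robust : Subset n → Set
  Robust B = Connected B × (∀ x → x ∈ B → Connected (B - x))

  -- A block: a maximal such vertex set (maximal subgraphs with this property
  -- are induced, since adding edges preserves connectivity).
  IsBlock : Subset n → Set
  IsBlock B = Robust B × (∀ B' → B ⊆ B' → Robust B' → B' ⊆ B)

  Complete : Subset n → Set
  Complete B = ∀ u v → u ∈ B → v ∈ B → u ≢ v → adj G u v ≡ true

  IsBlockGraph : Set
  IsBlockGraph = ∀ B → IsBlock B → Complete B

  -- diam(G) ≤ d : every pair of vertices is at distance ≤ d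
  -- (in particular G is connected).
  DiamLE : ℕ → Set
  DiamLE d = ∀ u v → ∃[ k ] (k ≤ d × Walk ⊤ u v k)

  IsComponentOf : Subset n → Fin n → Subset n → Set
  IsComponentOf A v C = ∀ w → (w ∈ C ⇔ Reach A v w)

  RIndependent : ℕ → Subset n → Set
  RIndependent r A = ∀ v → v ∈ A → ∀ C → IsComponentOf A v C → ∣ C ∣ ≤ r

Complex : ℕ → Set₁
Complex n = Subset n → Set

Ind : ∀ {n} → ℕ → Graph n → Complex n
Ind r G = RIndependent G r

module _ {n : ℕ} where

  IsFacet : Complex n → Subset n → Set
  IsFacet Δ σ = Δ σ × (∀ τ → Δ τ → σ ⊆ τ → τ ≡ σ)

  -- Δ is pure of dimension (m - 2) where m is given:
  -- every facet σ has dim σ = m - 2, i.e. ∣ σ ∣ + 1 = m.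
  -- (Used with m = ∣ F ∣, i.e. dimension dim F - 1.)
  PureOfDimSizeMinusOne : Complex n → Subset n → Set
  PureOfDimSizeMinusOne Δ F = ∀ σ → IsFacet Δ σ → ∣ σ ∣ + 1 ≡ ∣ F ∣

  ShellIntersection : ∀ {t} → (Fin t → Subset n) → Fin t → Complex n
  ShellIntersection F k σ = σ ⊆ F k × ∃[ j ] (toℕ j N.< toℕ k × σ ⊆ F j)

  -- Shellability of a (not necessarily pure) simplicial complex:
  -- an enumeration F of all facets without repetition such that for every
  -- k > 1 (0-indexed: toℕ k > 0), ⟨F_k⟩ ∩ ⟨F_1..F_{k-1}⟩ is pure of
  -- dimension dim F_k - 1.
  Shellable : Complex n → Set
  Shellable Δ =
    Σ ℕ λ t → Σ (Fin t → Subset n) λ F →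
      (∀ i j → F i ≡ F j → i ≡ j) ×
      (∀ i → IsFacet Δ (F i)) ×
      (∀ σ → IsFacet Δ σ → ∃[ i ] F i ≡ σ) ×
      (∀ k → 0 N.< toℕ k → PureOfDimSizeMinusOne (ShellIntersection F k) (F k))

-- Ind_r(G) is shelled by deciding vertices one at a time. For S ⊆ W consider the faces A with
-- S ⊆ A ⊆ W. If W is a face, it is the only facet. Otherwise choose a shedding vertex u ∈ W ∖ S:
-- every such A ∋ u can be changed to a face A - u + x with x ∈ W ∖ A. Then the facets avoiding u,
-- followed by those containing u, form a shelling.
--
-- In a block graph two neighbours of c that are joined by a path avoiding c are adjacent. Hence
-- the middle c of a longest geodesic is within distance 2 of every vertex, each vertex at distance
-- 2 from c has a unique parent among the neighbours of c, and adjacent vertices at distance 2 have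
-- the same parent. The shedding vertex is c itself if c is undecided and W - c is r-independent.
-- Otherwise take a component D of W (of W - c if c is undecided) with more than r vertices. If D
-- contains an undecided neighbour of c, the one with the most children in W is shedding;
-- otherwise every undecided vertex of D is.
module Submission where

open import Defs renaming (sym to adj-sym)
open import Data.Nat using (ℕ; zero; suc; _≤_; _<_; _+_; _∸_; s≤s; z≤n; _≤?_; _<?_)
import Data.Nat.Properties as ℕ
open import Data.Nat.Induction using (<-wellFounded)
open import Induction.WellFounded using (Acc; acc)
open import Data.Bool using (true)
import Data.Bool.Properties as Bool
open import Data.Fin using (Fin; zero; suc; toℕ; opposite; _≟_)
import Data.Fin.Properties as Fin
open import Data.Fin.Subset using
  (Subset; inside; outside; _∈_; _∉_; _⊆_; _∪_; _∩_; _─_; _-_; ⁅_⁆; ∣_∣; ⊤; ⊥; ∁)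
open import Data.Fin.Subset.Properties
open import Data.Vec using ([]; _∷_; tabulate; here; there)
open import Data.Vec.Properties using (lookup∘tabulate; lookup⇒[]=; []=⇒lookup)
open import Data.List using (List; []; _∷_; _++_; length; lookup)
open import Data.List.Membership.Propositional using () renaming (_∈_ to _∈ₗ_)
open import Data.List.Membership.Propositional.Properties using (∈-lookup; ∈-++⁺ˡ; ∈-++⁺ʳ; ∈-++⁻)
open import Data.List.Relation.Unary.Any using (here; there; index)
open import Data.List.Relation.Unary.Any.Properties using (lookup-index)
open import Data.Product using (∃; _×_; _,_; proj₁; proj₂)
open import Data.Sum using (_⊎_; inj₁; inj₂; [_,_]′)
import Data.Unit as Unit
open import Data.Empty using (⊥-elim)
open import Function using (_∘_; id)
open import Function.Bundles using (mk⇔; Equivalence)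
open import Relation.Binary.Definitions using (tri<; tri≈; tri>)
open import Relation.Binary.PropositionalEquality
  using (_≡_; _≢_; refl; sym; trans; cong; subst; subst₂)
open import Relation.Nullary using (¬_; Dec; yes; no; does; contradiction)
open import Relation.Nullary.Decidable
  using (¬?; _×-dec_; _⊎-dec_; _→-dec_; decidable-stable; map′)
open import Relation.Unary using (Decidable)

-- Finite subsets: adding and removing one vertex, comprehension.

infixl 5 _⊕_

_⊕_ : ∀ {n} → Subset n → Fin n → Subset n
p ⊕ x = p ∪ ⁅ x ⁆

module _ {n : ℕ} where

  x∈p⊕x : ∀ (p : Subset n) x → x ∈ p ⊕ x
  x∈p⊕x p x = x∈p∪q⁺ (inj₂ (x∈⁅x⁆ x))

  p⊆p⊕x : ∀ (p : Subset n) x → p ⊆ p ⊕ x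
  p⊆p⊕x p x = p⊆p∪q ⁅ x ⁆

  ∈⊕⁻ : ∀ (p : Subset n) {x y} → y ∈ p ⊕ x → y ∈ p ⊎ y ≡ x
  ∈⊕⁻ p {x} y∈ with x∈p∪q⁻ p ⁅ x ⁆ y∈
  ... | inj₁ y∈p = inj₁ y∈p
  ... | inj₂ y∈x = inj₂ (x∈⁅y⁆⇒x≡y x y∈x)

  ⊕⊆ : ∀ {p q : Subset n} {x} → p ⊆ q → x ∈ q → p ⊕ x ⊆ q
  ⊕⊆ {p} p⊆q x∈q y∈ with ∈⊕⁻ p y∈
  ... | inj₁ y∈p  = p⊆q y∈p
  ... | inj₂ refl = x∈q

∈─⁻ : ∀ {n} (p q : Subset n) {x} → x ∈ p ─ q → x ∈ p × x ∉ q
∈─⁻ (_ ∷ _) (outside ∷ _) here = here , λ ()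
∈─⁻ (_ ∷ p) (inside ∷ q) (there x∈) with ∈─⁻ p q x∈
... | x∈p , x∉q = there x∈p , λ { (there x∈q) → x∉q x∈q }
∈─⁻ (_ ∷ p) (outside ∷ q) (there x∈) with ∈─⁻ p q x∈
... | x∈p , x∉q = there x∈p , λ { (there x∈q) → x∉q x∈q }

∣p∩q∣+∣p─q∣≡∣p∣ : ∀ {n} (p q : Subset n) → ∣ p ∩ q ∣ + ∣ p ─ q ∣ ≡ ∣ p ∣
∣p∩q∣+∣p─q∣≡∣p∣ [] [] = refl
∣p∩q∣+∣p─q∣≡∣p∣ (outside ∷ p) (outside ∷ q) = ∣p∩q∣+∣p─q∣≡∣p∣ p q
∣p∩q∣+∣p─q∣≡∣p∣ (outside ∷ p) (inside ∷ q) = ∣p∩q∣+∣p─q∣≡∣p∣ p q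
∣p∩q∣+∣p─q∣≡∣p∣ (inside ∷ p) (inside ∷ q) = cong suc (∣p∩q∣+∣p─q∣≡∣p∣ p q)
∣p∩q∣+∣p─q∣≡∣p∣ (inside ∷ p) (outside ∷ q) =
  trans (ℕ.+-suc ∣ p ∩ q ∣ ∣ p ─ q ∣) (cong suc (∣p∩q∣+∣p─q∣≡∣p∣ p q))

module _ {n : ℕ} where

  ∈-⁻ : ∀ (p : Subset n) {x y} → y ∈ p - x → y ∈ p × y ≢ x
  ∈-⁻ p {x} y∈ with ∈─⁻ p ⁅ x ⁆ y∈
  ... | y∈p , y∉x = y∈p , λ { refl → y∉x (x∈⁅x⁆ x) }

  p-x⊆p : ∀ (p : Subset n) x → p - x ⊆ p
  p-x⊆p p x = p─q⊆p p ⁅ x ⁆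

  ∣p-x∣+1≡∣p∣ : ∀ (p : Subset n) {x} → x ∈ p → ∣ p - x ∣ + 1 ≡ ∣ p ∣
  ∣p-x∣+1≡∣p∣ p {x} x∈p =
    trans (ℕ.+-comm ∣ p - x ∣ 1)
      (trans (cong (_+ ∣ p - x ∣) (sym (trans (cong ∣_∣ p∩x≡x) (∣⁅x⁆∣≡1 x))))
        (∣p∩q∣+∣p─q∣≡∣p∣ p ⁅ x ⁆))
    where
    p∩x≡x : p ∩ ⁅ x ⁆ ≡ ⁅ x ⁆
    p∩x≡x = ⊆-antisym (p∩q⊆q p ⁅ x ⁆)
      (λ y∈x → x∈p∩q⁺ (subst (_∈ p) (sym (x∈⁅y⁆⇒x≡y x y∈x)) x∈p , y∈x))

  ⊈⇒witness : ∀ {p q : Subset n} → ¬ (p ⊆ q) → ∃ λ x → x ∈ p × x ∉ q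
  ⊈⇒witness {p} {q} p⊈q with Fin.any? (λ x → (x ∈? p) ×-dec ¬? (x ∈? q))
  ... | yes w = w
  ... | no ¬w = contradiction
    (λ {x} x∈p → decidable-stable (x ∈? q) (λ x∉q → ¬w (x , x∈p , x∉q))) p⊈q

  comprehension : ∀ {P : Fin n → Set} → Decidable P → Subset n
  comprehension P? = tabulate (does ∘ P?)

  ∈-comprehension⁺ : ∀ {P : Fin n → Set} (P? : Decidable P) {x} → P x → x ∈ comprehension P?
  ∈-comprehension⁺ P? {x} px = lookup⇒[]= x _ (trans (lookup∘tabulate (does ∘ P?) x) (lem (P? x)))
    where
    lem : (d : Dec _) → does d ≡ true
    lem (yes _)  = refl
    lem (no ¬px) = contradiction px ¬px

  ∈-comprehension⁻ : ∀ {P : Fin n → Set} (P? : Decidable P) {x} → x ∈ comprehension P? → P x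
  ∈-comprehension⁻ {P} P? {x} x∈ =
    lem (P? x) (trans (sym (lookup∘tabulate (does ∘ P?) x)) ([]=⇒lookup x∈))
    where
    lem : (d : Dec (P x)) → does d ≡ true → P x
    lem (yes px) _ = px

-- Shellings as lists of facets.

-- The facet added last comes first in the list.
Shelling : ∀ {n} → List (Subset n) → Set
Shelling []      = Unit.⊤
Shelling (F ∷ L) =
  (∀ {H} → H ∈ₗ L → ∃ λ x → x ∈ F × x ∉ H × ∃ λ K → K ∈ₗ L × F - x ⊆ K) × Shelling L

module _ {n : ℕ} where

  Shelling-lookup : ∀ (L : List (Subset n)) → Shelling L → ∀ i j → toℕ i < toℕ j →
    ∃ λ x → x ∈ lookup L i × x ∉ lookup L j ×
      ∃ λ k → toℕ i < toℕ k × lookup L i - x ⊆ lookup L k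
  Shelling-lookup (F ∷ L) (new , _) zero (suc j) _ with new (∈-lookup j)
  ... | x , x∈F , x∉H , K , K∈L , F-x⊆K =
    x , x∈F , x∉H , suc (index K∈L) , s≤s z≤n , subst (F - x ⊆_) (lookup-index K∈L) F-x⊆K
  Shelling-lookup (F ∷ L) (_ , old) (suc i) (suc j) (s≤s i<j) with Shelling-lookup L old i j i<j
  ... | x , x∈ , x∉ , k , i<k , ⊆k = x , x∈ , x∉ , suc k , s≤s i<k , ⊆k

  opposite-< : ∀ {m} {i j : Fin m} → toℕ i < toℕ j → toℕ (opposite j) < toℕ (opposite i)
  opposite-< {m} {i} {j} i<j = subst₂ _<_ (sym (Fin.opposite-prop j)) (sym (Fin.opposite-prop i))
    (ℕ.∸-monoʳ-< (s≤s i<j) (Fin.toℕ<n j))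

  Shelling-distinct : ∀ (L : List (Subset n)) → Shelling L → ∀ {i j} → toℕ i < toℕ j →
    lookup L i ≢ lookup L j
  Shelling-distinct L sh {i} {j} i<j eq with Shelling-lookup L sh i j i<j
  ... | x , x∈ , x∉ , _ = x∉ (subst (x ∈_) eq x∈)

  Shelling⇒Shellable : ∀ {Δ : Complex n} (L : List (Subset n)) → Shelling L →
    (∀ {σ} → σ ∈ₗ L → IsFacet Δ σ) → (∀ {σ} → IsFacet Δ σ → σ ∈ₗ L) → Shellable Δ
  Shelling⇒Shellable {Δ} L sh sound complete =
    length L , F , inj , (λ i → sound (∈-lookup (opposite i))) , surj , pure
    where
    -- The list starts with the newest facet, so the shelling order reads it backwards.
    F : Fin (length L) → Subset n
    F i = lookup L (opposite i)

    inj : ∀ i j → F i ≡ F j → i ≡ j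
    inj i j eq with ℕ.<-cmp (toℕ i) (toℕ j)
    ... | tri< i<j _ _ = contradiction (sym eq) (Shelling-distinct L sh (opposite-< i<j))
    ... | tri≈ _ i≡j _ = Fin.toℕ-injective i≡j
    ... | tri> _ _ j<i = contradiction eq (Shelling-distinct L sh (opposite-< j<i))

    surj : ∀ σ → IsFacet Δ σ → ∃ λ i → F i ≡ σ
    surj σ fσ = opposite (index σ∈L) ,
      trans (cong (lookup L) (Fin.opposite-involutive (index σ∈L))) (sym (lookup-index σ∈L))
      where σ∈L = complete fσ

    pure : ∀ k → 0 < toℕ k → PureOfDimSizeMinusOne (ShellIntersection F k) (F k)
    pure k _ σ ((σ⊆Fk , j , j<k , σ⊆Fj) , max)
      with Shelling-lookup L sh (opposite k) (opposite j) (opposite-< j<k)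
    ... | x , x∈Fk , x∉Fj , i , k<i , Fk-x⊆Fi =
      trans (cong (λ τ → ∣ τ ∣ + 1) (sym Fk-x≡σ)) (∣p-x∣+1≡∣p∣ (F k) x∈Fk)
      where
      i′<k : toℕ (opposite i) < toℕ k
      i′<k = subst (toℕ (opposite i) <_) (cong toℕ (Fin.opposite-involutive k)) (opposite-< k<i)
      -- `F j` misses `x`, so `σ` lies in `F k - x`; this set belongs to the intersection, and
      -- maximality of `σ` forces equality.
      Fk-x≡σ : F k - x ≡ σ
      Fk-x≡σ = max (F k - x)
        ( p-x⊆p (F k) x , opposite i , i′<k
        , subst (λ m → F k - x ⊆ lookup L m) (sym (Fin.opposite-involutive i)) Fk-x⊆Fi)
        (λ y∈σ → x∈p∧x≢y⇒x∈p-y (σ⊆Fk y∈σ) λ { refl → x∉Fj (σ⊆Fj y∈σ) })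

-- Shellability from shedding vertices.

module Shedding {n : ℕ} (Δ : Complex n) (Δ? : ∀ A → Dec (Δ A))
  (hereditary : ∀ {A B} → A ⊆ B → Δ B → Δ A) where

  -- For a face `S`, the sets `σ ─ S` are the facets of the link of `S` in the restriction of `Δ` to
  -- `W`.
  record FacetBetween (S W σ : Subset n) : Set where
    constructor facet
    field
      face  : Δ σ
      above : S ⊆ σ
      below : σ ⊆ W
      maximal : ∀ τ → Δ τ → τ ⊆ W → σ ⊆ τ → τ ⊆ σ
  open FacetBetween

  Sheds : Subset n → Subset n → Fin n → Set
  Sheds S W u = ∀ A → Δ A → S ⊆ A → A ⊆ W → u ∈ A → ∃ λ x → x ∈ W × x ∉ A × Δ (A - u ⊕ x)

  record ShelledBetween (S W : Subset n) : Set where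
    field
      facets   : List (Subset n)
      sound    : ∀ {σ} → σ ∈ₗ facets → FacetBetween S W σ
      complete : ∀ {σ} → FacetBetween S W σ → σ ∈ₗ facets
      shelling : Shelling facets
  open ShelledBetween

  -- The number of undecided vertices is the termination measure. The last premise says that `u` has
  -- been decided, by leaving `W` or by entering `S`.
  gap-shrinks : ∀ {S W S′ W′ : Subset n} {u} → S ⊆ S′ → W′ ⊆ W → u ∈ W → u ∉ S →
    (u ∈ W′ → u ∈ S′) → ∣ W′ ─ S′ ∣ < ∣ W ─ S ∣
  gap-shrinks {S} {W} {S′} {W′} S⊆ ⊆W u∈W u∉S used = p⊂q⇒∣p∣<∣q∣
    ( (λ y∈ → let y∈W′ , y∉S′ = ∈─⁻ W′ S′ y∈ in x∈p∧x∉q⇒x∈p─q (⊆W y∈W′) (y∉S′ ∘ S⊆))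
    , _ , x∈p∧x∉q⇒x∈p─q u∈W u∉S
    , λ u∈ → let u∈W′ , u∉S′ = ∈─⁻ W′ S′ u∈ in u∉S′ (used u∈W′))

  extend : ∀ S W → Acc _<_ ∣ W ─ S ∣ → S ⊆ W → Δ S → ∃ (FacetBetween S W)
  extend S W (acc rs) S⊆W δS with Fin.any? (λ x → (x ∈? W) ×-dec ¬? (x ∈? S) ×-dec Δ? (S ⊕ x))
  ... | yes (x , x∈W , x∉S , δ)
    with extend (S ⊕ x) W
           (rs (gap-shrinks (p⊆p⊕x S x) id x∈W x∉S (λ _ → x∈p⊕x S x))) (⊕⊆ S⊆W x∈W) δ
  ...   | σ , fσ = σ , facet (face fσ) (above fσ ∘ p⊆p⊕x S x) (below fσ) (maximal fσ)
  -- Testing single vertices suffices: a face containing `S` and another vertex `x` contains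
  -- `S ⊕ x`, which is then a face.
  extend S W _ S⊆W δS | no ¬x = S , facet δS id S⊆W λ τ δτ τ⊆W S⊆τ {x} x∈τ →
    decidable-stable (x ∈? S) λ x∉S → ¬x (x , τ⊆W x∈τ , x∉S , hereditary (⊕⊆ S⊆τ x∈τ) δτ)

  module _ (shed : ∀ S W → S ⊆ W → Δ S → ¬ Δ W → ∃ λ u → u ∈ W × u ∉ S × Sheds S W u) where

    module _ {S W u} (u∉S : u ∉ S) (sheds : Sheds S W u)
      (del : ShelledBetween S (W - u)) (link : ShelledBetween (S ⊕ u) W) where

      -- This is where shedding is used. If a larger face `τ` contained `u`, exchanging `u` for some
      -- `x` outside `τ` would give a face in `W - u` properly containing `σ`.
      facet-del : ∀ {σ} → FacetBetween S (W - u) σ → FacetBetween S W σ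
      facet-del {σ} fσ = facet (face fσ) (above fσ) (p-x⊆p W u ∘ below fσ) max
        where
        u∉σ : u ∉ σ
        u∉σ u∈σ = proj₂ (∈-⁻ W (below fσ u∈σ)) refl
        max : ∀ τ → Δ τ → τ ⊆ W → σ ⊆ τ → τ ⊆ σ
        max τ δτ τ⊆W σ⊆τ with u ∈? τ
        ... | no u∉τ = maximal fσ τ δτ
          (λ y∈τ → x∈p∧x≢y⇒x∈p-y (τ⊆W y∈τ) λ { refl → u∉τ y∈τ }) σ⊆τ
        ... | yes u∈τ with sheds τ δτ (σ⊆τ ∘ above fσ) τ⊆W u∈τ
        ...   | x , x∈W , x∉τ , δ = contradiction
          (σ⊆τ (maximal fσ (τ - u ⊕ x) δ
            (⊕⊆ (λ y∈ → let y∈τ , y≢u = ∈-⁻ τ y∈ in x∈p∧x≢y⇒x∈p-y (τ⊆W y∈τ) y≢u)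
                (x∈p∧x≢y⇒x∈p-y x∈W λ { refl → x∉τ u∈τ }))
            (λ y∈σ → p⊆p⊕x (τ - u) x (x∈p∧x≢y⇒x∈p-y (σ⊆τ y∈σ) λ { refl → u∉σ y∈σ }))
            (x∈p⊕x (τ - u) x))) x∉τ

      facet-link : ∀ {σ} → FacetBetween (S ⊕ u) W σ → FacetBetween S W σ
      facet-link fσ = facet (face fσ) (above fσ ∘ p⊆p⊕x S u) (below fσ) (maximal fσ)

      -- Compared with a facet that avoids `u`, a facet `F` containing `u` drops `u` itself: `F - u`
      -- extends to a facet inside `W - u`, which comes earlier in the shelling.
      shelling-++ : ∀ L → (∀ {σ} → σ ∈ₗ L → FacetBetween (S ⊕ u) W σ) → Shelling L →
        Shelling (L ++ facets del)
      shelling-++ [] _ _ = shelling del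
      shelling-++ (F ∷ L) fac (new , old) = new′ , shelling-++ L (fac ∘ there) old
        where
        fF = fac (here refl)
        u∈F = above fF (x∈p⊕x S u)
        new′ : ∀ {H} → H ∈ₗ L ++ facets del →
          ∃ λ x → x ∈ F × x ∉ H × ∃ λ K → K ∈ₗ L ++ facets del × F - x ⊆ K
        new′ H∈ with ∈-++⁻ L H∈
        ... | inj₁ H∈L = let x , x∈F , x∉H , K , K∈L , ⊆K = new H∈L in
          x , x∈F , x∉H , K , ∈-++⁺ˡ K∈L , ⊆K
        ... | inj₂ H∈del with extend (F - u) (W - u) (<-wellFounded _)
               (λ y∈ → let y∈F , y≢u = ∈-⁻ F y∈ in x∈p∧x≢y⇒x∈p-y (below fF y∈F) y≢u)
               (hereditary (p-x⊆p F u) (face fF))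
        ...   | K , fK = u , u∈F , (λ u∈H → proj₂ (∈-⁻ W (below (sound del H∈del) u∈H)) refl) ,
          K , ∈-++⁺ʳ L (complete del (facet (face fK)
            (λ y∈S → above fK (x∈p∧x≢y⇒x∈p-y (above fF (p⊆p⊕x S u y∈S)) λ { refl → u∉S y∈S }))
            (below fK) (maximal fK))) , above fK

      combine : ShelledBetween S W
      combine .facets = facets link ++ facets del
      combine .sound σ∈ with ∈-++⁻ (facets link) σ∈
      ... | inj₁ σ∈link = facet-link (sound link σ∈link)
      ... | inj₂ σ∈del  = facet-del (sound del σ∈del)
      combine .complete {σ} fσ with u ∈? σ
      ... | yes u∈σ = ∈-++⁺ˡ (complete link
        (facet (face fσ) (⊕⊆ (above fσ) u∈σ) (below fσ) (maximal fσ)))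
      ... | no u∉σ = ∈-++⁺ʳ (facets link) (complete del
        (facet (face fσ) (above fσ)
          (λ y∈σ → x∈p∧x≢y⇒x∈p-y (below fσ y∈σ) λ { refl → u∉σ y∈σ })
          (λ τ δτ τ⊆ → maximal fσ τ δτ (p-x⊆p W u ∘ τ⊆))))
      combine .shelling = shelling-++ (facets link) (sound link) (shelling link)

    shelledBetween : ∀ S W → Acc _<_ ∣ W ─ S ∣ → S ⊆ W → ShelledBetween S W
    shelledBetween S W (acc rs) S⊆W with Δ? S
    -- `S` grows without a check that it stays a face; if it fails, there are no facets.
    ... | no ¬δS = record
      { facets = [] ; sound = λ () ; shelling = Unit.tt
      ; complete = λ fσ → contradiction (hereditary (above fσ) (face fσ)) ¬δS }
    ... | yes δS with Δ? W
    ...   | yes δW = record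
      { facets = W ∷ []
      ; sound = λ { (here refl) → facet δW S⊆W id (λ τ _ τ⊆W _ → τ⊆W) }
      ; shelling = (λ ()) , Unit.tt
      ; complete = λ fσ → here (⊆-antisym (below fσ) (maximal fσ W δW id (below fσ))) }
    ...   | no ¬δW with shed S W S⊆W δS ¬δW
    ...     | u , u∈W , u∉S , sheds = combine u∉S sheds
      (shelledBetween S (W - u)
        (rs (gap-shrinks id (p-x⊆p W u) u∈W u∉S λ u∈ → contradiction refl (proj₂ (∈-⁻ W u∈))))
        (λ y∈S → x∈p∧x≢y⇒x∈p-y (S⊆W y∈S) λ { refl → u∉S y∈S }))
      (shelledBetween (S ⊕ u) W
        (rs (gap-shrinks (p⊆p⊕x S u) id u∈W u∉S λ _ → x∈p⊕x S u)) (⊕⊆ S⊆W u∈W))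

    sheds⇒Shellable : Shellable Δ
    sheds⇒Shellable = Shelling⇒Shellable (facets all) (shelling all)
      (λ σ∈ → let fσ = sound all σ∈ in
        face fσ , λ τ δτ σ⊆τ → ⊆-antisym (maximal fσ τ δτ ⊆⊤ σ⊆τ) σ⊆τ)
      (λ (δσ , max) → complete all
        (facet δσ (⊥-elim ∘ ∉⊥) ⊆⊤ (λ τ δτ _ σ⊆τ → ⊆-reflexive (max τ δτ σ⊆τ))))
      where all = shelledBetween ⊥ ⊤ (<-wellFounded _) (⊥-elim ∘ ∉⊥)

-- Walks, reachability and components.

module Reachability {n : ℕ} (G : Graph n) where

  Adj : Fin n → Fin n → Set
  Adj u v = adj G u v ≡ true

  Adj? : ∀ u v → Dec (Adj u v)
  Adj? u v = adj G u v Bool.≟ true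

  Adj-sym : ∀ {u v} → Adj u v → Adj v u
  Adj-sym {u} {v} uv = trans (adj-sym G v u) uv

  Adj⇒≢ : ∀ {u v} → Adj u v → u ≢ v
  Adj⇒≢ {u} uu refl with trans (sym uu) (irrefl G u)
  ... | ()

  module _ {A : Subset n} where

    walk-start : ∀ {u v k} → Walk G A u v k → u ∈ A
    walk-start (here u∈A)     = u∈A
    walk-start (step u∈A _ _) = u∈A

    walk-end : ∀ {u v k} → Walk G A u v k → v ∈ A
    walk-end (here v∈A)   = v∈A
    walk-end (step _ _ p) = walk-end p

    walk-++ : ∀ {u v w k l} → Walk G A u v k → Walk G A v w l → Walk G A u w (k + l)
    walk-++ (here _)         q = q
    walk-++ (step u∈A uw p) q = step u∈A uw (walk-++ p q)

    walk-reverse : ∀ {u v k} → Walk G A u v k → Walk G A v u k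
    walk-reverse (here u∈A) = here u∈A
    walk-reverse {k = suc k} (step u∈A uw p) = subst (Walk G A _ _) (ℕ.+-comm k 1)
      (walk-++ (walk-reverse p) (step (walk-start p) (Adj-sym uw) (here u∈A)))

    reach-start : ∀ {u v} → Reach G A u v → u ∈ A
    reach-start (_ , p) = walk-start p

    reach-end : ∀ {u v} → Reach G A u v → v ∈ A
    reach-end (_ , p) = walk-end p

    reach-refl : ∀ {u} → u ∈ A → Reach G A u u
    reach-refl u∈A = 0 , here u∈A

    reach-step : ∀ {u w v} → u ∈ A → Adj u w → Reach G A w v → Reach G A u v
    reach-step u∈A uw (k , p) = suc k , step u∈A uw p

    reach-edge : ∀ {u v} → u ∈ A → v ∈ A → Adj u v → Reach G A u v
    reach-edge u∈A v∈A uv = reach-step u∈A uv (reach-refl v∈A)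

    reach-trans : ∀ {u v w} → Reach G A u v → Reach G A v w → Reach G A u w
    reach-trans (_ , p) (_ , q) = _ , walk-++ p q

    reach-sym : ∀ {u v} → Reach G A u v → Reach G A v u
    reach-sym (_ , p) = _ , walk-reverse p

    reach-mono : ∀ {B u v} → A ⊆ B → Reach G A u v → Reach G B u v
    reach-mono A⊆B (_ , p) = _ , mono p
      where
      mono : ∀ {u v k} → Walk G A u v k → Walk G _ u v k
      mono (here u∈A)       = here (A⊆B u∈A)
      mono (step u∈A uw p) = step (A⊆B u∈A) uw (mono p)

  -- The last visit of x cuts a walk into a part that is thrown away and a part avoiding x.
  last-visit : ∀ {A} x {z v k} → Walk G A z v k →
    Reach G (A - x) z v ⊎ x ≡ v ⊎ ∃ λ w → Adj x w × Reach G (A - x) w v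
  last-visit x {v = v} (here v∈A) with x ≟ v
  ... | yes x≡v = inj₂ (inj₁ x≡v)
  ... | no x≢v  = inj₁ (reach-refl (x∈p∧x≢y⇒x∈p-y v∈A (x≢v ∘ sym)))
  last-visit x {z} (step z∈A zw p) with last-visit x p
  ... | inj₂ visit = inj₂ visit
  ... | inj₁ r with z ≟ x
  ...   | yes refl = inj₂ (inj₂ (_ , zw , r))
  ...   | no z≢x   = inj₁ (reach-step (x∈p∧x≢y⇒x∈p-y z∈A z≢x) zw r)

  -- What follows the last visit of `u` lives in the smaller set `A - u`, so that `reach?` and
  -- `thin` can recurse on the set.
  reach-first-step : ∀ {A u v} → Reach G A u v → u ≢ v →
    ∃ λ w → Adj u w × Reach G (A - u) w v
  reach-first-step {A} {u} (_ , p) u≢v with last-visit u p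
  ... | inj₁ r            = contradiction refl (proj₂ (∈-⁻ A (reach-start r)))
  ... | inj₂ (inj₁ u≡v)  = contradiction u≡v u≢v
  ... | inj₂ (inj₂ exit) = exit

  reach? : ∀ A u v → Dec (Reach G A u v)
  reach? A = go A (<-wellFounded _)
    where
    go : ∀ A → Acc _<_ ∣ A ∣ → ∀ u v → Dec (Reach G A u v)
    go A (acc rs) u v with u ∈? A
    ... | no u∉A = no (u∉A ∘ reach-start)
    ... | yes u∈A with u ≟ v
    ...   | yes refl = yes (reach-refl u∈A)
    ...   | no u≢v = map′
      (λ (w , uw , r) → reach-step u∈A uw (reach-mono (p-x⊆p A u) r))
      (λ r → reach-first-step r u≢v)
      (Fin.any? λ w → Adj? u w ×-dec go (A - u) (rs (x∈p⇒∣p-x∣<∣p∣ u∈A)) w v)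

  opaque
    component : Subset n → Fin n → Subset n
    component A v = comprehension (reach? A v)

    ∈-component⁺ : ∀ {A v w} → Reach G A v w → w ∈ component A v
    ∈-component⁺ {A} {v} = ∈-comprehension⁺ (reach? A v)

    ∈-component⁻ : ∀ {A v w} → w ∈ component A v → Reach G A v w
    ∈-component⁻ {A} {v} = ∈-comprehension⁻ (reach? A v)

  component⊆ : ∀ {A v} → component A v ⊆ A
  component⊆ = reach-end ∘ ∈-component⁻

  hub⇒connected : ∀ {A h} → (∀ {y} → y ∈ A → Reach G A y h) → Connected G A
  hub⇒connected toHub u v u∈A v∈A = reach-trans (toHub u∈A) (reach-sym (toHub v∈A))

  -- Independent sets and the exchange of one vertex.

  module Independence (r : ℕ) where

    Indep : Subset n → Set
    Indep = RIndependent G r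

    indep⇒∣component∣≤r : ∀ {A v} → Indep A → v ∈ A → ∣ component A v ∣ ≤ r
    indep⇒∣component∣≤r indA v∈A = indA _ v∈A _ (λ w → mk⇔ ∈-component⁻ ∈-component⁺)

    indep-bound : ∀ {A v X} → Indep A → v ∈ A → (∀ {y} → y ∈ X → Reach G A v y) → ∣ X ∣ ≤ r
    indep-bound indA v∈A reach =
      ℕ.≤-trans (p⊆q⇒∣p∣≤∣q∣ (∈-component⁺ ∘ reach)) (indep⇒∣component∣≤r indA v∈A)

    ∣component∣≤r⇒indep : ∀ {A} → (∀ v → v ∈ A → ∣ component A v ∣ ≤ r) → Indep A
    ∣component∣≤r⇒indep bound v v∈A C isC =
      ℕ.≤-trans (p⊆q⇒∣p∣≤∣q∣ (λ {w} → ∈-component⁺ ∘ Equivalence.to (isC w))) (bound v v∈A)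

    indep? : ∀ A → Dec (Indep A)
    indep? A = map′ ∣component∣≤r⇒indep (λ indA v → indep⇒∣component∣≤r indA)
      (Fin.all? λ v → (v ∈? A) →-dec (∣ component A v ∣ ≤? r))

    indep-hereditary : ∀ {A B} → A ⊆ B → Indep B → Indep A
    indep-hereditary A⊆B indB = ∣component∣≤r⇒indep λ v v∈A →
      indep-bound indB (A⊆B v∈A) (reach-mono A⊆B ∘ ∈-component⁻)

    large-component : ∀ {A} → ¬ Indep A → ∃ λ v → v ∈ A × ¬ ∣ component A v ∣ ≤ r
    large-component {A} ¬indA
      with Fin.any? (λ v → (v ∈? A) ×-dec ¬? (∣ component A v ∣ ≤? r))
    ... | yes w = w
    ... | no ¬w = contradiction
      (∣component∣≤r⇒indep λ v v∈A → decidable-stable (_ ≤? r) λ ¬≤ → ¬w (v , v∈A , ¬≤)) ¬indA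

    -- Walks from `v` stay in its component. If `B` contained that component, it would lie in a
    -- single component of `B`, which would be too large.
    large-component-⊈ : ∀ {A B v} → v ∈ A → ¬ ∣ component A v ∣ ≤ r → Indep B →
      ¬ component A v ⊆ B
    large-component-⊈ {A} {B} {v} v∈A big indB C⊆B =
      big (indep-bound indB (C⊆B (∈-component⁺ (reach-refl v∈A))) (inB ∘ proj₂ ∘ ∈-component⁻))
      where
      inB : ∀ {k y} → Walk G A v y k → Reach G B v y
      inB p = go (reach-refl v∈A) p
        where
        go : ∀ {x y k} → Reach G A v x → Walk G A x y k → Reach G B x y
        go vx (here _) = reach-refl (C⊆B (∈-component⁺ vx))
        go vx (step x∈A xz q) = reach-step (C⊆B (∈-component⁺ vx)) xz
          (go (reach-trans vx (reach-edge x∈A (walk-start q) xz)) q)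

    module _ {A : Subset n} (indA : Indep A) (u x : Fin n) where

      private
        A′ = A - u ⊕ x

        ∈A : ∀ {y} → y ∈ A′ → y ≢ x → y ∈ A
        ∈A y∈ y≢x with ∈⊕⁻ (A - u) y∈
        ... | inj₁ y∈A-u = p-x⊆p A u y∈A-u
        ... | inj₂ y≡x   = contradiction y≡x y≢x

      -- A component of `A′` without `x` lies in a component of `A`, so only the component of `x`
      -- can be too large.
      exchange : ∣ component A′ x ∣ ≤ r → Indep A′
      exchange bound = ∣component∣≤r⇒indep λ v v∈A′ → go v v∈A′ (reach? A′ v x)
        where
        inA : ∀ {v y k} → ¬ Reach G A′ v x → Walk G A′ v y k → Reach G A v y
        inA ¬vx (here v∈) = reach-refl (∈A v∈ λ { refl → ¬vx (reach-refl v∈) })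
        inA ¬vx (step v∈ vw p) = reach-step (∈A v∈ λ { refl → ¬vx (reach-refl v∈) }) vw
          (inA (¬vx ∘ reach-step v∈ vw) p)
        go : ∀ v → v ∈ A′ → Dec (Reach G A′ v x) → ∣ component A′ v ∣ ≤ r
        go v v∈ (yes vx) = ℕ.≤-trans
          (p⊆q⇒∣p∣≤∣q∣ (∈-component⁺ ∘ reach-trans (reach-sym vx) ∘ ∈-component⁻)) bound
        go v v∈ (no ¬vx) = indep-bound indA (∈A v∈ λ { refl → ¬vx (reach-refl v∈) })
          (inA ¬vx ∘ proj₂ ∘ ∈-component⁻)

      -- The component of x in A - u ⊕ x consists of x and of vertices of the component of u in A.
      exchange-neighbours : u ∈ A → x ∉ A →
        (∀ y → y ∈ A → Adj x y → Reach G A y u) → Indep A′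
      exchange-neighbours u∈A x∉A toU = exchange (begin
        ∣ component A′ x ∣              ≡⟨ ∣p-x∣+1≡∣p∣ _ (∈-component⁺ (reach-refl (x∈p⊕x (A - u) x))) ⟨
        ∣ component A′ x - x ∣ + 1      ≤⟨ ℕ.+-monoˡ-≤ 1 (p⊆q⇒∣p∣≤∣q∣ inclusion) ⟩
        ∣ component A u - u ∣ + 1       ≡⟨ ∣p-x∣+1≡∣p∣ _ (∈-component⁺ (reach-refl u∈A)) ⟩
        ∣ component A u ∣               ≤⟨ indep⇒∣component∣≤r indA u∈A ⟩
        r                               ∎)
        where
        open ℕ.≤-Reasoning
        reachU : ∀ {y k} → Walk G A′ y x k → y ≡ x ⊎ Reach G A y u
        reachU (here _) = inj₁ refl
        reachU {y} (step y∈ yz p) with y ≟ x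
        ... | yes y≡x = inj₁ y≡x
        ... | no y≢x with reachU p
        ...   | inj₁ refl = inj₂ (toU y (∈A y∈ y≢x) (Adj-sym yz))
        ...   | inj₂ zu   = inj₂ (reach-step (∈A y∈ y≢x) yz zu)
        inclusion : component A′ x - x ⊆ component A u - u
        inclusion y∈ with ∈-⁻ (component A′ x) y∈
        ... | y∈C , y≢x with reachU (proj₂ (reach-sym (∈-component⁻ y∈C)))
        ...   | inj₁ y≡x = contradiction y≡x y≢x
        ...   | inj₂ yu  = x∈p∧x≢y⇒x∈p-y (∈-component⁺ (reach-sym yu)) λ { refl →
          [ (λ y∈A-u → proj₂ (∈-⁻ A y∈A-u) refl) , y≢x ]′ (∈⊕⁻ (A - u) (component⊆ y∈C)) }

  -- Paths, cycles and chords in block graphs.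

  -- The vertex set of a path from a to b.
  record Thin (A : Subset n) (a b : Fin n) : Set where
    field
      support  : Subset n
      ⊆A       : support ⊆ A
      a∈       : a ∈ support
      toEnd    : ∀ {y} → y ∈ support → Reach G support y b
      toEnds   : ∀ {x y} → x ∈ support → y ∈ support - x →
                 Reach G (support - x) y a ⊎ Reach G (support - x) y b
  open Thin

  -- Prepending `a` to a path inside `A - a` repeats no vertex, so deleting one vertex leaves every
  -- other one joined to an end.
  thin : ∀ {a b} A → Acc _<_ ∣ A ∣ → Reach G A a b → Thin A a b
  thin {a} {b} A (acc rs) ab with a ≟ b
  ... | yes refl = record
    { support = ⁅ a ⁆
    ; ⊆A = λ y∈ → subst (_∈ A) (sym (x∈⁅y⁆⇒x≡y a y∈)) (reach-start ab)
    ; a∈ = x∈⁅x⁆ a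
    ; toEnd = λ y∈ → subst (λ y → Reach G ⁅ a ⁆ y a) (sym (x∈⁅y⁆⇒x≡y a y∈)) (reach-refl (x∈⁅x⁆ a))
    ; toEnds = λ x∈ y∈ → let y∈a , y≢x = ∈-⁻ ⁅ a ⁆ y∈ in
        contradiction (trans (x∈⁅y⁆⇒x≡y a y∈a) (sym (x∈⁅y⁆⇒x≡y a x∈))) y≢x }
  ... | no a≢b with reach-first-step ab a≢b
  ...   | w , aw , wb with thin (A - a) (rs (x∈p⇒∣p-x∣<∣p∣ (reach-start ab))) wb
  ...     | T = record
    { support = E
    ; ⊆A = ⊕⊆ (p-x⊆p A a ∘ ⊆A T) (reach-start ab)
    ; a∈ = a∈E
    ; toEnd = end
    ; toEnds = ends }
    where
    E = support T ⊕ a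
    a∈E = x∈p⊕x (support T) a
    end : ∀ {y} → y ∈ E → Reach G E y b
    end y∈ with ∈⊕⁻ (support T) y∈
    ... | inj₁ y∈T  = reach-mono (p⊆p⊕x _ a) (toEnd T y∈T)
    ... | inj₂ refl = reach-step a∈E aw (reach-mono (p⊆p⊕x _ a) (toEnd T (a∈ T)))
    a∉T : a ∉ support T
    a∉T a∈T = proj₂ (∈-⁻ A (⊆A T a∈T)) refl
    ends : ∀ {x y} → x ∈ E → y ∈ E - x → Reach G (E - x) y a ⊎ Reach G (E - x) y b
    ends {x} {y} x∈ y∈ with ∈-⁻ E y∈
    ... | y∈E , y≢x with ∈⊕⁻ (support T) x∈ | ∈⊕⁻ (support T) y∈E
    ...   | inj₂ refl | inj₂ y≡a  = contradiction y≡a y≢x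
    ...   | inj₁ _    | inj₂ refl = inj₁ (reach-refl y∈)
    ...   | inj₂ refl | inj₁ y∈T  = inj₂ (reach-mono
      (λ z∈ → x∈p∧x≢y⇒x∈p-y (p⊆p⊕x _ a z∈) λ { refl → a∉T z∈ }) (toEnd T y∈T))
    ...   | inj₁ x∈T  | inj₁ y∈T  with toEnds T x∈T (x∈p∧x≢y⇒x∈p-y y∈T y≢x)
    -- The shorter path starts at `w`; whatever still reaches `w` goes on to `a`, which is not the
    -- deleted vertex.
    ...     | inj₁ yw = inj₁ (reach-trans (reach-mono T-x⊆ yw)
      (reach-edge (T-x⊆ (reach-end yw)) (x∈p∧x≢y⇒x∈p-y a∈E λ { refl → a∉T x∈T }) (Adj-sym aw)))
      where
      T-x⊆ : support T - x ⊆ E - x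
      T-x⊆ z∈ = let z∈T , z≢x = ∈-⁻ (support T) z∈ in x∈p∧x≢y⇒x∈p-y (p⊆p⊕x _ a z∈T) z≢x
    ...     | inj₂ yb = inj₂ (reach-mono
      (λ z∈ → let z∈T , z≢x = ∈-⁻ (support T) z∈ in x∈p∧x≢y⇒x∈p-y (p⊆p⊕x _ a z∈T) z≢x) yb)

  module BlockGraph (blockGraph : IsBlockGraph G) where

    -- A larger robust set is complete by induction, so a missing edge `uv` excludes all of them.
    -- Then `B` is itself a block, hence complete.
    robust⇒complete : ∀ B → Acc _<_ ∣ ∁ B ∣ → Robust G B → Complete G B
    robust⇒complete B (acc rs) robust u v u∈B v∈B u≢v = decidable-stable (Adj? u v) λ ¬uv →
      ¬uv (blockGraph B
        ( robust
        , λ B′ B⊆B′ robust′ {x} x∈B′ → decidable-stable (x ∈? B) λ x∉B →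
            ¬uv (robust⇒complete B′ (rs (p⊂q⇒∣p∣<∣q∣ (p⊂q⇒∁p⊃∁q (B⊆B′ , x , x∈B′ , x∉B))))
              robust′ u v (B⊆B′ u∈B) (B⊆B′ v∈B) u≢v))
        u v u∈B v∈B u≢v)

    -- A path from a to b avoiding c closes up through c to a cycle, which is robust.
    chord : ∀ {a b c} → Adj c a → Adj c b → Reach G (⊤ - c) a b → a ≢ b → Adj a b
    chord {a} {b} {c} ca cb ab = robust⇒complete B (<-wellFounded _)
      (hub⇒connected toC , λ x x∈B → minus x (∈⊕⁻ E x∈B)) a b
      (p⊆p⊕x E c (a∈ T)) (p⊆p⊕x E c b∈E)
      where
      T = thin (⊤ - c) (<-wellFounded _) ab
      E = support T
      B = E ⊕ c
      b∈E = reach-end (toEnd T (a∈ T))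
      c∉E : c ∉ E
      c∉E c∈E = proj₂ (∈-⁻ ⊤ (⊆A T c∈E)) refl
      toC : ∀ {y} → y ∈ B → Reach G B y c
      toC y∈ with ∈⊕⁻ E y∈
      ... | inj₂ refl = reach-refl y∈
      ... | inj₁ y∈E  = reach-trans (reach-mono (p⊆p⊕x E c) (toEnd T y∈E))
        (reach-edge (p⊆p⊕x E c b∈E) (x∈p⊕x E c) (Adj-sym cb))
      -- Without `c` the path still joins everything to `b`. Without a path vertex, each remaining
      -- one is joined to an end, and both ends are neighbours of `c`.
      minus : ∀ x → x ∈ E ⊎ x ≡ c → Connected G (B - x)
      minus x (inj₂ refl) = hub⇒connected λ y∈ → let y∈B , y≢c = ∈-⁻ B y∈ in
        reach-mono (λ z∈E → x∈p∧x≢y⇒x∈p-y (p⊆p⊕x E c z∈E) λ { refl → c∉E z∈E })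
          (toEnd T ([ id , (λ y≡c → contradiction y≡c y≢c) ]′ (∈⊕⁻ E y∈B)))
      minus x (inj₁ x∈E) = hub⇒connected toC′
        where
        E-x⊆ : E - x ⊆ B - x
        E-x⊆ z∈ = let z∈E , z≢x = ∈-⁻ E z∈ in x∈p∧x≢y⇒x∈p-y (p⊆p⊕x E c z∈E) z≢x
        c∈ : c ∈ B - x
        c∈ = x∈p∧x≢y⇒x∈p-y (x∈p⊕x E c) λ { refl → c∉E x∈E }
        viaEnd : ∀ {y e} → Adj c e → Reach G (E - x) y e → Reach G (B - x) y c
        viaEnd ce ye = reach-trans (reach-mono E-x⊆ ye)
          (reach-edge (E-x⊆ (reach-end ye)) c∈ (Adj-sym ce))
        toC′ : ∀ {y} → y ∈ B - x → Reach G (B - x) y c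
        toC′ y∈ with ∈-⁻ B y∈
        ... | y∈B , y≢x with ∈⊕⁻ E y∈B
        ...   | inj₂ refl = reach-refl y∈
        ...   | inj₁ y∈E = [ viaEnd ca , viaEnd cb ]′ (toEnds T x∈E (x∈p∧x≢y⇒x∈p-y y∈E y≢x))

  -- Distances and a central vertex.

  Near : ℕ → Fin n → Fin n → Set
  Near k u v = ∃ λ j → j ≤ k × Walk G ⊤ u v j

  near? : ∀ k u v → Dec (Near k u v)
  near? k u v with u ≟ v
  ... | yes refl = yes (0 , z≤n , here ∈⊤)
  near? zero u v    | no u≢v = no λ { (0 , _ , here _) → u≢v refl }
  near? (suc k) u v | no u≢v = map′
    (λ (w , uw , j , j≤k , p) → suc j , s≤s j≤k , step ∈⊤ uw p)
    (λ { (0 , _ , here _) → contradiction refl u≢v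
       ; (suc j , s≤s j≤k , step _ uw p) → _ , uw , j , j≤k , p })
    (Fin.any? λ w → Adj? u w ×-dec near? k w v)

  near-sym : ∀ {k u v} → Near k u v → Near k v u
  near-sym (j , j≤k , p) = j , j≤k , walk-reverse p

  near-trans : ∀ {k l u v w} → Near k u v → Near l v w → Near (k + l) u w
  near-trans (i , i≤k , p) (j , j≤l , q) = i + j , ℕ.+-mono-≤ i≤k j≤l , walk-++ p q

  near-mono : ∀ {k l u v} → k ≤ l → Near k u v → Near l u v
  near-mono k≤l (j , j≤k , p) = j , ℕ.≤-trans j≤k k≤l , p

  near-edge : ∀ {u v} → Adj u v → Near 1 u v
  near-edge uv = 1 , ℕ.≤-refl , step ∈⊤ uv (here ∈⊤)

  -- The cut is at the first visit of `c`; the two lengths are kept for the counting in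
  -- `separator-central`.
  walk-through : ∀ c {u v k} → Walk G ⊤ u v k →
    Reach G (⊤ - c) u v ⊎ ∃ λ i → ∃ λ j → i + j ≡ k × Walk G ⊤ u c i × Walk G ⊤ c v j
  walk-through c {u} p with u ≟ c
  ... | yes refl = inj₂ (0 , _ , refl , here ∈⊤ , p)
  walk-through c (here _) | no u≢c = inj₁ (reach-refl (x∈p∧x≢y⇒x∈p-y ∈⊤ u≢c))
  walk-through c (step _ uw p) | no u≢c with walk-through c p
  ... | inj₁ wv = inj₁ (reach-step (x∈p∧x≢y⇒x∈p-y ∈⊤ u≢c) uw wv)
  ... | inj₂ (i , j , eq , q , q′) = inj₂ (suc i , j , cong suc eq , step ∈⊤ uw q , q′)

  ⊤-edge : ∀ {c u v} → u ≢ c → v ≢ c → Adj u v → Reach G (⊤ - c) u v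
  ⊤-edge u≢c v≢c = reach-edge (x∈p∧x≢y⇒x∈p-y ∈⊤ u≢c) (x∈p∧x≢y⇒x∈p-y ∈⊤ v≢c)

  module Center (blockGraph : IsBlockGraph G) where
    open BlockGraph blockGraph

    -- c is the middle of a geodesic from u to v through a and b.
    separator-central : ∀ {a b c u v} d → DiamLE G (3 + d) →
      Adj c a → Adj c b → a ≢ b → ¬ Adj a b →
      Reach G (⊤ - c) u a → Reach G (⊤ - c) v b →
      ¬ Near d c u → ¬ Near d c v → ∀ w → Near 2 w c
    separator-central {a} {b} {c} {u} {v} d diam ca cb a≢b ¬ab ua vb ¬cu ¬cv w =
      -- Otherwise `u` and `v` are joined through `w` avoiding `c`, hence so are `a` and `b`, and
      -- the chord makes them adjacent.
      decidable-stable (near? 2 w c) λ ¬wc →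
        ¬ab (chord ca cb
          (reach-trans (reach-sym ua)
            (reach-trans (reach-sym (avoid ¬wc ¬cu)) (reach-trans (avoid ¬wc ¬cv) vb)))
          a≢b)
      where
      -- A walk of length at most `3 + d` from `w` through `c` spends at least 3 steps before `c`,
      -- leaving at most `d` to reach an end farther than `d` from `c`.
      avoid : ∀ {v} → ¬ Near 2 w c → ¬ Near d c v → Reach G (⊤ - c) w v
      avoid {v} ¬wc ¬cv with diam w v
      ... | k , k≤ , p with walk-through c p
      ...   | inj₁ wv = wv
      ...   | inj₂ (i , j , refl , q , q′) with i ≤? 2
      ...     | yes i≤2 = contradiction (i , i≤2 , q) ¬wc
      ...     | no i≰2 = contradiction
        (j , ℕ.+-cancelˡ-≤ 3 j d (ℕ.≤-trans (ℕ.+-monoˡ-≤ j (ℕ.≰⇒> i≰2)) k≤) , q′) ¬cv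

    -- The cases are diameter 4, 3 and at most 2; in the last any vertex serves. In the others the
    -- side conditions hold because their failure would shorten the geodesic from `u` to `v`.
    center : DiamLE G 4 → Fin n → ∃ λ c → ∀ w → Near 2 w c
    center diam v₀ with Fin.any? (λ u → Fin.any? λ v → ¬? (near? 3 u v))
    ... | yes (u , v , ¬uv) = go (diam u v)
      where
      go : Near 4 u v → ∃ λ c → ∀ w → Near 2 w c
      go (suc (suc (suc (suc zero))) , _ ,
          step _ ua (step {w = c} _ ac (step _ cb (step _ bv (here _))))) =
        c , separator-central 1 diam (Adj-sym ac) cb
          (λ { refl → ¬uv (near-mono (ℕ.n≤1+n 2) (near-trans (near-edge ua) (near-edge bv))) })
          (λ ab → ¬uv (near-trans (near-edge ua) (near-trans (near-edge ab) (near-edge bv))))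
          (⊤-edge (λ { refl → ¬uv (near-mono (ℕ.n≤1+n 2) cv) }) (Adj⇒≢ ac) ua)
          (⊤-edge (λ { refl → ¬uv (near-mono (ℕ.n≤1+n 2) uc) }) (Adj⇒≢ (Adj-sym cb)) (Adj-sym bv))
          (λ cu → ¬uv (near-trans (near-sym cu) cv))
          (λ cv′ → ¬uv (near-trans uc cv′))
        where
        uc = near-trans (near-edge ua) (near-edge ac)
        cv = near-trans (near-edge cb) (near-edge bv)
      go (suc (suc (suc (suc (suc _)))) , s≤s (s≤s (s≤s (s≤s ()))) , _)
      go (0 , _ , p) = contradiction (0 , z≤n , p) ¬uv
      go (1 , _ , p) = contradiction (1 , s≤s z≤n , p) ¬uv
      go (2 , _ , p) = contradiction (2 , s≤s (s≤s z≤n) , p) ¬uv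
      go (3 , _ , p) = contradiction (3 , ℕ.≤-refl , p) ¬uv
    ... | no ¬far with Fin.any? (λ u → Fin.any? λ v → ¬? (near? 2 u v))
    ...   | no ¬far₂ = v₀ , λ w → decidable-stable (near? 2 w v₀) λ ¬wv → ¬far₂ (w , v₀ , ¬wv)
    ...   | yes (u , v , ¬uv) = go (diam₃ u v)
      where
      diam₃ : DiamLE G 3
      diam₃ u v = decidable-stable (near? 3 u v) λ ¬uv → ¬far (u , v , ¬uv)
      go : Near 3 u v → ∃ λ c → ∀ w → Near 2 w c
      -- Here `u` plays the role of `a`, and `c` is the second vertex. With `d = 0` the last two
      -- conditions only say that `c` differs from `u` and `v`.
      go (suc (suc (suc zero)) , _ , step _ uc (step {w = b} _ cb (step _ bv (here _)))) =
        _ , separator-central 0 diam₃ (Adj-sym uc) cb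
          (λ { refl → ¬uv (near-mono (ℕ.n≤1+n 1) (near-edge bv)) })
          (λ ub → ¬uv (near-trans (near-edge ub) (near-edge bv)))
          (reach-refl (x∈p∧x≢y⇒x∈p-y ∈⊤ (Adj⇒≢ uc)))
          (⊤-edge (λ { refl → ¬uv (near-mono (ℕ.n≤1+n 1) (near-edge uc)) })
            (Adj⇒≢ (Adj-sym cb)) (Adj-sym bv))
          (λ cu → ¬uv (near-trans (near-sym cu) (near-trans (near-edge cb) (near-edge bv))))
          (λ cv → ¬uv (near-mono (ℕ.n≤1+n 1) (near-trans (near-edge uc) cv)))
      go (suc (suc (suc (suc _))) , s≤s (s≤s (s≤s ())) , _)
      go (0 , _ , p) = contradiction (0 , z≤n , p) ¬uv
      go (1 , _ , p) = contradiction (1 , s≤s z≤n , p) ¬uv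
      go (2 , _ , p) = contradiction (2 , ℕ.≤-refl , p) ¬uv

maximizer : ∀ {m n} {P : Fin n → Set} → Decidable P → (f : Fin n → ℕ) → (∀ i → f i ≤ m) →
  ∃ P → ∃ λ i → P i × (∀ j → P j → f j ≤ f i)
maximizer {m} {P = P} P? f f≤m (i , pi) = go i pi (<-wellFounded _)
  where
  go : ∀ i → P i → Acc _<_ (m ∸ f i) → ∃ λ i → P i × (∀ j → P j → f j ≤ f i)
  go i pi (acc rs) with Fin.any? (λ j → P? j ×-dec (f i <? f j))
  ... | yes (j , pj , fi<fj) = go j pj (rs (ℕ.∸-monoʳ-< fi<fj (f≤m j)))
  ... | no ¬better = i , pi , λ j pj → ℕ.≮⇒≥ λ fi<fj → ¬better (j , pj , fi<fj)

-- The graph rooted at a central vertex: parents, children, branches.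

module Rooted {n : ℕ} (G : Graph n) (blockGraph : IsBlockGraph G)
  (c : Fin n) (near : ∀ w → Reachability.Near G 2 w c) where
  open Reachability G
  open BlockGraph blockGraph

  -- By `near`, these are the vertices at distance exactly 2 from `c`.
  Outer : Fin n → Set
  Outer x = x ≢ c × ¬ Adj c x

  Child : Fin n → Fin n → Set
  Child b x = Adj b x × Outer x

  kind : ∀ x → x ≡ c ⊎ Adj c x ⊎ Outer x
  kind x with x ≟ c | Adj? c x
  ... | yes x≡c | _      = inj₁ x≡c
  ... | no _    | yes cx = inj₂ (inj₁ cx)
  ... | no x≢c  | no ¬cx = inj₂ (inj₂ (x≢c , ¬cx))

  child? : ∀ b x → Dec (Child b x)
  child? b x = Adj? b x ×-dec ¬? (x ≟ c) ×-dec ¬? (Adj? c x)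

  parent : ∀ {x} → Outer x → ∃ λ b → Adj c b × Child b x
  parent {x} out@(x≢c , ¬cx) with near x
  ... | 0 , _ , here _ = contradiction refl x≢c
  ... | 1 , _ , step _ xc (here _) = contradiction (Adj-sym xc) ¬cx
  ... | 2 , _ , step _ xb (step _ bc (here _)) = _ , Adj-sym bc , Adj-sym xb , out
  ... | suc (suc (suc _)) , s≤s (s≤s ()) , _

  -- A path from c to the child x of b that avoids b would make c and x adjacent.
  child-separated : ∀ {b x} → Adj c b → Child b x → ¬ Reach G (⊤ - b) c x
  child-separated cb (bx , x≢c , ¬cx) cx = ¬cx (chord (Adj-sym cb) bx cx (x≢c ∘ sym))

  -- A second parent `b′` would give the path `c`, `b′`, `x` avoiding `b`.
  child-adj-inner : ∀ {b b′ x} → Adj c b → Child b x → Adj c b′ → Adj b′ x → b′ ≡ b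
  child-adj-inner {b} {b′} cb child@(bx , _) cb′ b′x = decidable-stable (b′ ≟ b) λ b′≢b →
    child-separated cb child
      (reach-trans (⊤-edge (Adj⇒≢ cb) b′≢b cb′) (⊤-edge b′≢b (Adj⇒≢ (Adj-sym bx)) b′x))

  -- If `y` had a parent `b′` other than `b`, the path `c`, `b′`, `y`, `x` would avoid `b`.
  child-adj-outer : ∀ {b x y} → Adj c b → Child b x → Adj x y → Outer y → Child b y
  child-adj-outer {b} {x} {y} cb child@(bx , _) xy out@(_ , ¬cy) with parent out
  ... | b′ , cb′ , b′y , _ with b′ ≟ b
  ...   | yes refl = b′y , out
  ...   | no b′≢b = contradiction
    (reach-trans (⊤-edge (Adj⇒≢ cb) b′≢b cb′)
      (reach-trans (⊤-edge b′≢b y≢b b′y) (⊤-edge y≢b (Adj⇒≢ (Adj-sym bx)) (Adj-sym xy))))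
    (child-separated cb child)
    where
    y≢b : y ≢ b
    y≢b refl = ¬cy cb

  -- So the children of `b` are attached to the rest of the graph through `b` alone.
  child-adj : ∀ {b x y} → Adj c b → Child b x → Adj x y → y ≡ b ⊎ Child b y
  child-adj {y = y} cb child@(_ , _ , ¬cx) xy with kind y
  ... | inj₁ refl       = contradiction (Adj-sym xy) ¬cx
  ... | inj₂ (inj₁ cy)  = inj₁ (child-adj-inner cb child cy (Adj-sym xy))
  ... | inj₂ (inj₂ out) = inj₂ (child-adj-outer cb child xy out)

  -- By `child-adj` the walk stays among the children of `b` until it meets `b`.
  branch-exit : ∀ {A b x z k} → Adj c b → Child b x → Walk G A x z k →
    (Child b z × Reach G (A - b) x z) ⊎ Reach G A x b
  branch-exit cb child@(bx , _) (here x∈A) =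
    inj₁ (child , reach-refl (x∈p∧x≢y⇒x∈p-y x∈A (Adj⇒≢ (Adj-sym bx))))
  branch-exit cb child@(bx , _) (step x∈A xy p) with child-adj cb child xy
  ... | inj₁ refl   = inj₂ (reach-edge x∈A (walk-start p) xy)
  ... | inj₂ childy with branch-exit cb childy p
  ...   | inj₁ (childz , yz) =
    inj₁ (childz , reach-step (x∈p∧x≢y⇒x∈p-y x∈A (Adj⇒≢ (Adj-sym bx))) xy yz)
  ...   | inj₂ yb = inj₂ (reach-step x∈A xy yb)

  reach-parent : ∀ {A b x z} → Adj c b → Child b x → ¬ Child b z → Reach G A x z → Reach G A x b
  reach-parent cb child ¬childz (_ , p) with branch-exit cb child p
  ... | inj₁ (childz , _) = contradiction childz ¬childz
  ... | inj₂ xb           = xb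

  -- Feeds `exchange-neighbours` when the parent `q` of the added vertex `x` is present.
  neighbour-reach-parent : ∀ {A q x y} → Adj c q → Child q x → q ∈ A → y ∈ A → Adj x y →
    Reach G A y q
  neighbour-reach-parent cq child q∈A y∈A xy with child-adj cq child xy
  ... | inj₁ refl     = reach-refl y∈A
  ... | inj₂ (qy , _) = reach-edge y∈A q∈A (Adj-sym qy)

  Branch : Fin n → Fin n → Set
  Branch b x = x ≡ b ⊎ Child b x

  branch? : ∀ b → Decidable (Branch b)
  branch? b x = (x ≟ b) ⊎-dec child? b x

  branch : Fin n → Subset n
  branch b = comprehension (branch? b)

  -- Existence of a shedding vertex.

  module _ (r : ℕ) where
    open Independence r
    open Shedding Indep indep? indep-hereditary

    -- Any vertex of `W` outside `A` can replace `c`, since the result lies in `W - c`.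
    sheds-root : ∀ {S W} → c ∈ W → ¬ Indep W → Indep (W - c) → Sheds S W c
    sheds-root {S} {W} c∈W ¬indW indW-c A indA S⊆A A⊆W c∈A
      with ⊈⇒witness (λ W⊆A → ¬indW (indep-hereditary W⊆A indA))
    ... | x , x∈W , x∉A = x , x∈W , x∉A , indep-hereditary
      (⊕⊆ (λ y∈ → let y∈A , y≢c = ∈-⁻ A y∈ in x∈p∧x≢y⇒x∈p-y (A⊆W y∈A) y≢c)
          (x∈p∧x≢y⇒x∈p-y x∈W λ { refl → x∉A c∈A }))
      indW-c

    -- W′ is W, or W - c in case c is still undecided.
    module _ {S W W′ : Subset n} (W′⊆W : W′ ⊆ W)
      (root∈S : c ∈ W′ → c ∈ S) (W⊆W′ : ∀ {y} → y ∈ W → y ≢ c → y ∈ W′) where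

      -- If `c` is in `A`, it joins `p` to `q`. If not, `c` is not in `W′` either, so the connection
      -- in `W′` avoids `c` and the chord applies.
      core-reach : ∀ {A p q} → S ⊆ A → Adj c p → Adj c q → p ∈ A → q ∈ A →
        Reach G W′ p q → Reach G A p q
      core-reach {A} {p} {q} S⊆A cp cq p∈A q∈A pq with c ∈? A
      ... | yes c∈A = reach-trans (reach-edge p∈A c∈A (Adj-sym cp)) (reach-edge c∈A q∈A cq)
      ... | no c∉A with p ≟ q
      ...   | yes refl = reach-refl p∈A
      ...   | no p≢q = reach-edge p∈A q∈A (chord cp cq
        (reach-mono (λ y∈ → x∈p∧x≢y⇒x∈p-y ∈⊤ λ { refl → c∉A (S⊆A (root∈S y∈)) }) pq) p≢q)

      module _ {v} (v∈W′ : v ∈ W′) (big : ¬ ∣ component W′ v ∣ ≤ r) where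
        private D = component W′ v

        D⊆W′ : D ⊆ W′
        D⊆W′ = component⊆

        joined : ∀ {x y} → x ∈ D → y ∈ D → Reach G W′ x y
        joined x∈ y∈ = reach-trans (reach-sym (∈-component⁻ x∈)) (∈-component⁻ y∈)

        D-closed : ∀ {x y} → x ∈ D → Reach G W′ x y → y ∈ D
        D-closed x∈ xy = ∈-component⁺ (reach-trans (∈-component⁻ x∈) xy)

        -- Any `x` in `D` outside `A` can replace `u`: the neighbours of `c` in `D` all belong to
        -- `A`, which keeps the neighbours of `x` in `A` connected to `u`.
        sheds-outer : (∀ {b} → b ∈ D → Adj c b → b ∈ S) → ∀ {u} → u ∈ D → u ∉ S → Sheds S W u
        sheds-outer inner∈S {u} u∈D u∉S A indA S⊆A A⊆W u∈A
          with ⊈⇒witness (large-component-⊈ v∈W′ big indA)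
        ... | x , x∈D , x∉A = x , W′⊆W (D⊆W′ x∈D) , x∉A ,
            exchange-neighbours indA u x u∈A x∉A toU
          where
          outer : ∀ {y} → y ∈ D → y ∉ S → Outer y
          outer {y} y∈D y∉S with kind y
          ... | inj₁ refl       = contradiction (root∈S (D⊆W′ y∈D)) y∉S
          ... | inj₂ (inj₁ cy)  = contradiction (inner∈S y∈D cy) y∉S
          ... | inj₂ (inj₂ out) = out
          outu = outer u∈D u∉S
          outx = outer x∈D (x∉A ∘ S⊆A)
          toU : ∀ y → y ∈ A → Adj x y → Reach G A y u
          toU y y∈A xy with parent outx
          ... | q , cq , childx@(qx , _) with q ∈? W′
          -- The parent `p` of `u` is in `D` too, since a walk in `W′` from `u` to `q` must pass
          -- `p`. Both parents are in `S`, and `core-reach` joins them in `A`.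
          ...   | yes q∈W′ = reach-trans (neighbour-reach-parent cq childx q∈A y∈A xy) qu
            where
            q∈D = D-closed x∈D (reach-edge (D⊆W′ x∈D) q∈W′ (Adj-sym qx))
            q∈A = S⊆A (inner∈S q∈D cq)
            qu : Reach G A q u
            qu with parent outu
            ... | p , cp , childu@(pu , _) =
              reach-trans (core-reach S⊆A cq cp q∈A p∈A (joined q∈D p∈D)) (reach-edge p∈A u∈A pu)
              where
              p∈D = D-closed u∈D
                (reach-parent cp childu (λ (_ , _ , ¬cq) → ¬cq cq) (joined u∈D q∈D))
              p∈A = S⊆A (inner∈S p∈D cp)
          -- With `q` absent, the walk from `x` to `u` stays among the children of `q`. Thus `u` and
          -- `y` are both children of `q`, and they coincide or are adjacent by the chord at `q`.
          ...   | no q∉W′ with branch-exit cq childx (proj₂ (joined x∈D u∈D))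
          ...     | inj₂ xq = contradiction (reach-end xq) q∉W′
          ...     | inj₁ ((qu , _) , xu) with y ≟ u
          ...       | yes refl = reach-refl y∈A
          ...       | no y≢u with child-adj cq childx xy
          ...         | inj₁ refl = contradiction (W⊆W′ (A⊆W y∈A) (Adj⇒≢ (Adj-sym cq))) q∉W′
          ...         | inj₂ (qy , _) = reach-edge y∈A u∈A (chord qy qu
            (reach-trans (⊤-edge (Adj⇒≢ (Adj-sym qy)) (Adj⇒≢ (Adj-sym qx)) (Adj-sym xy))
              (reach-mono (λ z∈ → x∈p∧x≢y⇒x∈p-y ∈⊤ (proj₂ (∈-⁻ W′ z∈))) xu)) y≢u)

        module _ {b} (cb : Adj c b) (b∈D : b ∈ D)
          (largest : ∀ {b′} → b′ ∈ D → b′ ∉ S → Adj c b′ → ∣ branch b′ ∩ W ∣ ≤ ∣ branch b ∩ W ∣)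
          {A} (indA : Indep A) (S⊆A : S ⊆ A) (A⊆W : A ⊆ W) (b∈A : b ∈ A) where

          -- Replacing b by b′ turns the component of b into one that has lost the branch of b
          -- and gained at most the branch of b′.
          exchange-inner : (∀ {y} → Child b y → y ∈ W → y ∈ A) →
            ∀ {b′} → b′ ∈ D → b′ ∉ A → Adj c b′ → Indep (A - b ⊕ b′)
          exchange-inner children⊆A {b′} b′∈D b′∉A cb′ = exchange indA b b′ (begin
            ∣ E ∣
              ≡⟨ ∣p∩q∣+∣p─q∣≡∣p∣ E (branch b′) ⟨
            ∣ E ∩ branch b′ ∣ + ∣ E ─ branch b′ ∣
              ≤⟨ ℕ.+-mono-≤ (p⊆q⇒∣p∣≤∣q∣ gained) (p⊆q⇒∣p∣≤∣q∣ kept) ⟩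
            ∣ branch b′ ∩ W ∣ + ∣ component A b ─ branch b ∣
              ≤⟨ ℕ.+-monoˡ-≤ _ (ℕ.≤-trans (largest b′∈D (b′∉A ∘ S⊆A) cb′) (p⊆q⇒∣p∣≤∣q∣ lost)) ⟩
            ∣ component A b ∩ branch b ∣ + ∣ component A b ─ branch b ∣
              ≡⟨ ∣p∩q∣+∣p─q∣≡∣p∣ (component A b) (branch b) ⟩
            ∣ component A b ∣
              ≤⟨ indep⇒∣component∣≤r indA b∈A ⟩
            r ∎)
            where
            open ℕ.≤-Reasoning
            A′ = A - b ⊕ b′
            E = component A′ b′
            ∈A : ∀ {y} → y ∈ A′ → y ≢ b′ → y ∈ A
            ∈A y∈ y≢b′ with ∈⊕⁻ (A - b) y∈
            ... | inj₁ y∈A-b = p-x⊆p A b y∈A-b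
            ... | inj₂ y≡b′  = contradiction y≡b′ y≢b′
            A′⊆W : A′ ⊆ W
            A′⊆W = ⊕⊆ (A⊆W ∘ p-x⊆p A b) (W′⊆W (D⊆W′ b′∈D))
            b∉A′ : b ∉ A′
            b∉A′ b∈ with ∈⊕⁻ (A - b) b∈
            ... | inj₁ b∈A-b = proj₂ (∈-⁻ A b∈A-b) refl
            ... | inj₂ refl  = b′∉A b∈A
            gained : E ∩ branch b′ ⊆ branch b′ ∩ W
            gained y∈ = let y∈E , y∈H = x∈p∩q⁻ E (branch b′) y∈ in
              x∈p∩q⁺ (y∈H , A′⊆W (component⊆ y∈E))
            -- A child of `b` in `W` but missing from `A` would be counted on the left only;
            -- `children⊆A` excludes this.
            lost : branch b ∩ W ⊆ component A b ∩ branch b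
            lost y∈ with x∈p∩q⁻ (branch b) W y∈
            ... | y∈H , y∈W = x∈p∩q⁺ (∈-component⁺ (by (∈-comprehension⁻ (branch? b) y∈H)) , y∈H)
              where
              by : Branch b _ → Reach G A b _
              by (inj₁ refl) = reach-refl b∈A
              by (inj₂ child@(by , _)) = reach-edge b∈A (children⊆A child y∈W) by
            -- The last vertex of the walk outside the branch of `b′` is `c` or a neighbour of `c`,
            -- and either is joined to `b` inside `A`.
            toB : ∀ {e k} → Walk G A′ e b′ k → Branch b′ e ⊎ Reach G A e b
            toB (here _) = inj₁ (inj₁ refl)
            toB {e} (step e∈ ey p) with e ≟ b′
            ... | yes e≡b′ = inj₁ (inj₁ e≡b′)
            ... | no e≢b′ with toB p
            ...   | inj₂ yb = inj₂ (reach-step (∈A e∈ e≢b′) ey yb)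
            ...   | inj₁ (inj₂ childy) with child-adj cb′ childy (Adj-sym ey)
            ...     | inj₁ e≡b′   = contradiction e≡b′ e≢b′
            ...     | inj₂ childe = inj₁ (inj₂ childe)
            toB {e} (step e∈ ey p) | no e≢b′ | inj₁ (inj₁ refl) with kind e
            ... | inj₂ (inj₂ out) = inj₁ (inj₂ (Adj-sym ey , out))
            ... | inj₁ refl = inj₂ (reach-edge (∈A e∈ e≢b′) b∈A cb)
            ... | inj₂ (inj₁ ce) = inj₂ (core-reach S⊆A ce cb (∈A e∈ e≢b′) b∈A
              (reach-step (W⊆W′ (A′⊆W e∈) (Adj⇒≢ (Adj-sym ce))) ey (joined b′∈D b∈D)))
            -- A child of `b` could reach `b′` only through `b`, which is not in `A′`.
            kept : E ─ branch b′ ⊆ component A b ─ branch b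
            kept {y} y∈ with ∈─⁻ E (branch b′) y∈
            ... | y∈E , y∉H with reach-sym (∈-component⁻ y∈E)
            ...   | yb′ with toB (proj₂ yb′)
            ...     | inj₁ y∈H = contradiction (∈-comprehension⁺ (branch? b′) y∈H) y∉H
            ...     | inj₂ yb = x∈p∧x∉q⇒x∈p─q (∈-component⁺ (reach-sym yb))
              (outside-branch ∘ ∈-comprehension⁻ (branch? b))
              where
              outside-branch : ¬ Branch b y
              outside-branch (inj₁ refl) = b∉A′ (reach-start yb′)
              outside-branch (inj₂ child) =
                b∉A′ (reach-end (reach-parent cb child (λ (_ , _ , ¬cb′) → ¬cb′ cb′) yb′))

          -- A missing child of `b` is the first choice. If there is none, take `x` in `D` outside
          -- `A`: a neighbour of `c` is handled by `exchange-inner`, and for an outer vertex its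
          -- parent `q` is used if missing. If `q` is present, all neighbours of `x` in `A` reach
          -- `b` through `q`.
          inner-exchange : ∃ λ x → x ∈ W × x ∉ A × Indep (A - b ⊕ x)
          inner-exchange with Fin.any? (λ x → child? b x ×-dec (x ∈? W) ×-dec ¬? (x ∈? A))
          ... | yes (x , child , x∈W , x∉A) = x , x∈W , x∉A ,
            exchange-neighbours indA b x b∈A x∉A (λ y → neighbour-reach-parent cb child b∈A)
          ... | no ¬missing with ⊈⇒witness (large-component-⊈ v∈W′ big indA)
          ...   | x , x∈D , x∉A = by-kind (kind x)
            where
            children⊆A : ∀ {y} → Child b y → y ∈ W → y ∈ A
            children⊆A {y} child y∈W =
              decidable-stable (y ∈? A) λ y∉A → ¬missing (y , child , y∈W , y∉A)
            D⊆W : D ⊆ W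
            D⊆W = W′⊆W ∘ D⊆W′
            by-kind : x ≡ c ⊎ Adj c x ⊎ Outer x → ∃ λ x → x ∈ W × x ∉ A × Indep (A - b ⊕ x)
            by-kind (inj₁ refl) = contradiction (S⊆A (root∈S (D⊆W′ x∈D))) x∉A
            by-kind (inj₂ (inj₁ cx)) = x , D⊆W x∈D , x∉A , exchange-inner children⊆A x∈D x∉A cx
            by-kind (inj₂ (inj₂ out)) with parent out
            ... | q , cq , child with reach-parent cq child (λ (_ , _ , ¬cb) → ¬cb cb) (joined x∈D b∈D)
            ...   | xq with q ∈? A
            ...     | no q∉A = q , D⊆W q∈D , q∉A , exchange-inner children⊆A q∈D q∉A cq
              where q∈D = D-closed x∈D xq
            ...     | yes q∈A = x , D⊆W x∈D , x∉A ,
              exchange-neighbours indA b x b∈A x∉A λ y y∈A xy →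
                reach-trans (neighbour-reach-parent cq child q∈A y∈A xy)
                  (core-reach S⊆A cq cb q∈A b∈A (joined (D-closed x∈D xq) b∈D))

      sheds-large : Indep S → ¬ Indep W′ → ∃ λ u → u ∈ W × u ∉ S × Sheds S W u
      sheds-large indS ¬indW′ with large-component ¬indW′
      ... | v , v∈W′ , big = go (Fin.any? free?)
        where
        D = component W′ v
        D⊆W : D ⊆ W
        D⊆W = W′⊆W ∘ D⊆W′ v∈W′ big
        Free : Fin n → Set
        Free b = b ∈ D × b ∉ S × Adj c b
        free? : Decidable Free
        free? b = (b ∈? D) ×-dec ¬? (b ∈? S) ×-dec Adj? c b
        go : Dec (∃ Free) → ∃ λ u → u ∈ W × u ∉ S × Sheds S W u
        go (yes some)
          with maximizer free? (λ b → ∣ branch b ∩ W ∣) (λ b → ∣p∣≤n (branch b ∩ W)) some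
        ... | b , (b∈D , b∉S , cb) , largest = b , D⊆W b∈D , b∉S ,
          λ A → inner-exchange v∈W′ big cb b∈D
            λ b′∈D b′∉S cb′ → largest _ (b′∈D , b′∉S , cb′)
        -- `S` is independent, so it cannot contain `D`; some vertex of `D` is undecided.
        go (no none) with ⊈⇒witness (large-component-⊈ v∈W′ big indS)
        ... | u , u∈D , u∉S = u , D⊆W u∈D , u∉S , sheds-outer v∈W′ big
          (λ {b} b∈D cb → decidable-stable (b ∈? S) λ b∉S → none (b , b∈D , b∉S , cb)) u∈D u∉S

    shedding-vertex : ∀ S W → Indep S → ¬ Indep W →
      ∃ λ u → u ∈ W × u ∉ S × Sheds S W u
    shedding-vertex S W indS ¬indW with c ∈? S | c ∈? W
    ... | yes c∈S | _ = sheds-large id (λ _ → c∈S) (λ y∈W _ → y∈W) indS ¬indW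
    ... | no _ | no c∉W =
      sheds-large id (λ c∈W → contradiction c∈W c∉W) (λ y∈W _ → y∈W) indS ¬indW
    ... | no c∉S | yes c∈W with indep? (W - c)
    ...   | yes indW-c = c , c∈W , c∉S , sheds-root c∈W ¬indW indW-c
    ...   | no ¬indW-c = sheds-large (p-x⊆p W c)
      (λ c∈ → contradiction refl (proj₂ (∈-⁻ W c∈))) x∈p∧x≢y⇒x∈p-y indS ¬indW-c

theorem4p8 : ∀ {n} (G : Graph n) → IsBlockGraph G → DiamLE G 4 →
    ∀ (r : ℕ) → 2 ≤ r → Shellable (Ind r G)
theorem4p8 {n} G blockGraph diam r _ = sheds⇒Shellable shed
  where
  open Reachability G
  open Independence r
  open Shedding Indep indep? indep-hereditary
  shed : ∀ S W → S ⊆ W → Indep S → ¬ Indep W → ∃ λ u → u ∈ W × u ∉ S × Sheds S W u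
  shed S W _ indS ¬indW with large-component ¬indW
  -- Only the existence of `v` matters: `center` needs a vertex to start from, and a set that is not
  -- independent has one.
  ... | v , _ with Center.center blockGraph diam v
  ...   | c , near = Rooted.shedding-vertex G blockGraph c near r S W indS ¬indW
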